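{- Let $G$ be a connected $\Delta$-regular simple graph of order $n=2\Delta$. Let $k_3$ be the number of subsets of $V(G)$ of cardinality three that induce a connected subgraph of $G$. Then $G$ is isomorphic to the complete bipartite graph $K_{\Delta,\Delta}$ if and only if $k_3 = n\binom{\Delta}{2}$.
   Context: Graphs are finite, simple and have at least one vertex. The order of a graph is its number of vertices. -}

module Defs where

open import Data.Empty using (⊥)
open import Data.Fin using (Fin; zero; suc)
import Data.Fin.Properties as Fin
open import Data.Fin.Subset using (Subset; inside; outside; _∈_; ∣_∣)
open import Data.List using (List; []; _∷_; _++_; map; length; filter; allFin)
import Data.List.Membership.Propositional as List
open import Data.List.Membership.Propositional.Properties using (∈-map⁺)
open import Data.List.Relation.Unary.All using (lookup; all?; tabulate)
open import Data.List.Relation.Unary.Any using (here; there)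
open import Data.Nat using (ℕ; zero; suc; _≟_)
open import Data.Product using (∃; _×_; _,_; proj₁)
open import Data.Product.Properties using (≡-dec)
open import Data.Sum using (_⊎_; inj₁; inj₂)
open import Data.Unit using (⊤; tt)
open import Data.Vec using ([]; _∷_; here; there)
open import Data.Vec.Properties.WithK using ([]=-irrelevant)
open import Function using (_↔_; _⇔_; _on_; Inverse)
open import Level using (0ℓ)
open import Relation.Binary using (Rel; Decidable; DecidableEquality; Symmetric; Irreflexive)
open import Relation.Binary.Construct.Closure.ReflexiveTransitive using (Star; ε; _◅_; _◅◅_)
open import Relation.Binary.PropositionalEquality using (_≡_; refl)
open import Relation.Nullary using (Dec; yes; no)
open import Relation.Nullary.Decidable using (map′; _×-dec_; _⊎-dec_)

record SimpleGraph (V : Set) : Set₁ where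
  field
    Adj    : Rel V 0ℓ
    adj?   : Decidable Adj
    sym    : Symmetric Adj
    irrefl : Irreflexive _≡_ Adj

open SimpleGraph

record _≅_ {V W : Set} (G : SimpleGraph V) (H : SimpleGraph W) : Set where
  field
    bijection : V ↔ W
    adjacency : ∀ u v → Adj G u v ⇔ Adj H (Inverse.to bijection u) (Inverse.to bijection v)

-- Only the existence of walks is required, so the graph on an empty vertex
-- type counts as connected.
Connected : {V : Set} → SimpleGraph V → Set
Connected G = ∀ u v → Star (Adj G) u v

degree : ∀ {n} → SimpleGraph (Fin n) → Fin n → ℕ
degree {n} G v = length (filter (adj? G v) (allFin n))

Regular : ∀ {n} → ℕ → SimpleGraph (Fin n) → Set
Regular d G = ∀ v → degree G v ≡ d

completeBipartite : ∀ m n → SimpleGraph (Fin m ⊎ Fin n)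
completeBipartite m n = record
  { Adj    = adj
  ; adj?   = dec
  ; sym    = λ {u} {v} → symm u v
  ; irrefl = λ { {inj₁ _} refl () ; {inj₂ _} refl () }
  }
  where
  adj : Rel (Fin m ⊎ Fin n) 0ℓ
  adj (inj₁ _) (inj₁ _) = ⊥
  adj (inj₁ _) (inj₂ _) = ⊤
  adj (inj₂ _) (inj₁ _) = ⊤
  adj (inj₂ _) (inj₂ _) = ⊥

  dec : Decidable adj
  dec (inj₁ _) (inj₁ _) = no λ ()
  dec (inj₁ _) (inj₂ _) = yes tt
  dec (inj₂ _) (inj₁ _) = yes tt
  dec (inj₂ _) (inj₂ _) = no λ ()

  symm : ∀ u v → adj u v → adj v u
  symm (inj₁ _) (inj₂ _) _ = tt
  symm (inj₂ _) (inj₁ _) _ = tt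

-- Membership proofs are unique, so ∃ (_∈ S) has exactly one vertex for each
-- element of S.
induced : ∀ {n} → SimpleGraph (Fin n) → (S : Subset n) → SimpleGraph (∃ (_∈ S))
induced G S = record
  { Adj    = Adj G on proj₁
  ; adj?   = λ u v → adj? G (proj₁ u) (proj₁ v)
  ; sym    = sym G
  ; irrefl = λ { refl → irrefl G refl }
  }

-- Reachability in a finite graph is decided by the Floyd–Warshall recursion:
-- Via ks i j asks for a walk from i to j with all intermediate vertices in ks.
module _ {V : Set} (_≟ᵥ_ : DecidableEquality V) (G : SimpleGraph V) where

  private
    Via : List V → Rel V 0ℓ
    Via []       i j = i ≡ j ⊎ Adj G i j
    Via (k ∷ ks) i j = Via ks i j ⊎ (Via ks i k × Via ks k j)

    via? : ∀ ks → Decidable (Via ks)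
    via? []       i j = (i ≟ᵥ j) ⊎-dec adj? G i j
    via? (k ∷ ks) i j = via? ks i j ⊎-dec (via? ks i k ×-dec via? ks k j)

    via⇒star : ∀ ks {i j} → Via ks i j → Star (Adj G) i j
    via⇒star []       (inj₁ refl)    = ε
    via⇒star []       (inj₂ e)       = e ◅ ε
    via⇒star (k ∷ ks) (inj₁ p)       = via⇒star ks p
    via⇒star (k ∷ ks) (inj₂ (p , q)) = via⇒star ks p ◅◅ via⇒star ks q

    via-base : ∀ ks {i j} → i ≡ j ⊎ Adj G i j → Via ks i j
    via-base []       e = e
    via-base (k ∷ ks) e = inj₁ (via-base ks e)

    via-to : ∀ k ks {i} → Via (k ∷ ks) i k → Via ks i k
    via-to k ks (inj₁ p)       = p
    via-to k ks (inj₂ (p , _)) = p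

    via-from : ∀ k ks {j} → Via (k ∷ ks) k j → Via ks k j
    via-from k ks (inj₁ q)       = q
    via-from k ks (inj₂ (_ , q)) = q

    via-trans : ∀ ks {i m j} → m List.∈ ks → Via ks i m → Via ks m j → Via ks i j
    via-trans (k ∷ ks) (here refl) p q = inj₂ (via-to k ks p , via-from k ks q)
    via-trans (k ∷ ks) (there m∈) (inj₁ p)       (inj₁ q)       = inj₁ (via-trans ks m∈ p q)
    via-trans (k ∷ ks) (there m∈) (inj₁ p)       (inj₂ (q , r)) = inj₂ (via-trans ks m∈ p q , r)
    via-trans (k ∷ ks) (there m∈) (inj₂ (p , q)) (inj₁ r)       = inj₂ (p , via-trans ks m∈ q r)
    via-trans (k ∷ ks) (there m∈) (inj₂ (p , _)) (inj₂ (_ , r)) = inj₂ (p , r)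

  connected? : (vs : List V) → (∀ v → v List.∈ vs) → Dec (Connected G)
  connected? vs complete =
    map′ (λ ps u v → lookup (lookup ps (complete u)) (complete v))
         (λ c → tabulate λ {u} _ → tabulate λ {v} _ → c u v)
         (all? (λ u → all? (reachable? u) vs) vs)
    where
    star⇒via : ∀ {i j} → Star (Adj G) i j → Via vs i j
    star⇒via ε = via-base vs (inj₁ refl)
    star⇒via (_◅_ {j = m} e es) = via-trans vs (complete m) (via-base vs (inj₂ e)) (star⇒via es)

    reachable? : Decidable (Star (Adj G))
    reachable? u v = map′ (via⇒star vs) star⇒via (via? vs u v)

elements : ∀ {n} (S : Subset n) → List (∃ (_∈ S))
elements []            = []
elements (inside  ∷ S) = (zero , here) ∷ map (λ (v , v∈S) → suc v , there v∈S) (elements S)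
elements (outside ∷ S) = map (λ (v , v∈S) → suc v , there v∈S) (elements S)

elements-complete : ∀ {n} (S : Subset n) (v : ∃ (_∈ S)) → v List.∈ elements S
elements-complete (inside  ∷ S) (zero  , here)      = here refl
elements-complete (inside  ∷ S) (suc v , there v∈S) = there (∈-map⁺ _ (elements-complete S (v , v∈S)))
elements-complete (outside ∷ S) (suc v , there v∈S) = ∈-map⁺ _ (elements-complete S (v , v∈S))

inducedConnected? : ∀ {n} (G : SimpleGraph (Fin n)) (S : Subset n) → Dec (Connected (induced G S))
inducedConnected? G S =
  connected? (≡-dec Fin._≟_ λ p q → yes ([]=-irrelevant p q))
             (induced G S) (elements S) (elements-complete S)

subsets : ∀ n → List (Subset n)
subsets zero    = [] ∷ []
subsets (suc n) = map (inside ∷_) (subsets n) ++ map (outside ∷_) (subsets n)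

connectedSubsets : ∀ {n} → ℕ → SimpleGraph (Fin n) → ℕ
connectedSubsets {n} k G =
  length (filter (λ S → (∣ S ∣ ≟ k) ×-dec inducedConnected? G S) (subsets n))

-- A three-element set S of vertices induces a connected subgraph iff it has a
-- centre, a vertex of S adjacent to the two others; the centre is unique unless
-- S is a triangle. A vertex v is the centre of C(deg v, 2) sets, so
-- k₃ = n C(Δ, 2) says exactly that G is triangle-free. In that case the
-- neighbourhoods of adjacent vertices are disjoint and of size Δ = n / 2, hence
-- complementary, which makes G the complete bipartite graph between N(u) and
-- its complement.
module Submission where

import Algebra.Properties.CommutativeSemigroup as CommutativeSemigroup
open import Data.Bool using (true; false; if_then_else_)
open import Data.Fin using (Fin; zero; suc)
import Data.Fin.Properties as Fin
open import Data.Fin.Subset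
  using (Subset; inside; outside; _∈_; _∉_; _⊆_; ∣_∣; _∪_; _-_; ⁅_⁆; ∁)
open import Data.Fin.Subset.Properties
open import Data.List using (List; []; _∷_; _++_; map; length; filter; allFin)
import Data.List as List
import Data.List.Membership.Propositional as List
open import Data.List.Membership.Propositional.Properties
  using (∈-map⁺; ∈-++⁺ˡ; ∈-++⁺ʳ; ∈-filter⁺; ∈-filter⁻; ∈-length; ∈-allFin)
open import Data.List.Properties
  using (map-cong; length-++; filter-++; filter-≐; filter-none; length-tabulate)
open import Data.List.Relation.Unary.All using (universal; []; _∷_)
open import Data.List.Relation.Unary.AllPairs using ([]; _∷_)
open import Data.List.Relation.Unary.Any using (here; there)
open import Data.List.Relation.Unary.Unique.Propositional using (Unique)
import Data.List.Relation.Unary.Unique.Propositional.Properties as Unique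
open import Data.Nat using (ℕ; zero; suc; _+_; _*_; _∸_; _≤_; z≤n; s≤s; _≟_; NonZero)
open import Data.Nat.Combinatorics using (_C_; nCk+nC[k+1]≡[n+1]C[k+1])
open import Data.Nat.ListAction using (sum)
open import Data.Nat.Properties hiding (_≟_)
open import Data.Product using (∃; _×_; _,_; proj₂)
open import Data.Sum as Sum using (_⊎_; inj₁; inj₂)
open import Data.Vec using ([]; _∷_; here; there)
import Data.Vec as Vec
open import Data.Vec.Properties using ([]=⇒lookup; lookup⇒[]=; lookup∘tabulate)
open import Data.Vec.Properties.WithK using ([]=-irrelevant)
open import Function using (_⇔_; _∘_; case_of_; mk⇔; Equivalence; mk↔ₛ′)
open import Relation.Binary.Construct.Closure.ReflexiveTransitive using (Star; ε; _◅_; _◅◅_)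
open import Relation.Binary.PropositionalEquality
open import Relation.Nullary using (¬_; Dec; yes; no; does; contradiction)
open import Relation.Nullary.Decidable using (_×-dec_; dec-true)
open import Relation.Unary using (Pred; Decidable; _≐_)
open import Level using (0ℓ)
open import Defs

private
  variable
    A B : Set
    n   : ℕ

open CommutativeSemigroup +-commutativeSemigroup using (interchange)

-- Counting and summation

count : {P : Pred A 0ℓ} → Decidable P → List A → ℕ
count P? xs = length (filter P? xs)

𝟙 : {P : Set} → Dec P → ℕ
𝟙 P? = if does P? then 1 else 0

𝟙≤ : ∀ {P : Set} (P? : Dec P) {m} → (P → 1 ≤ m) → 𝟙 P? ≤ m
𝟙≤ (yes p) 1≤m = 1≤m p
𝟙≤ (no _)  _   = z≤n

≤𝟙 : ∀ {P : Set} (P? : Dec P) {m} → (P → m ≤ 1) → (¬ P → m ≡ 0) → m ≤ 𝟙 P?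
≤𝟙 (yes p) m≤1 _   = m≤1 p
≤𝟙 (no ¬p) _   m≡0 = ≤-reflexive (m≡0 ¬p)

module _ {P : Pred A 0ℓ} (P? : Decidable P) where

  count-∷ : ∀ x xs → count P? (x ∷ xs) ≡ 𝟙 (P? x) + count P? xs
  count-∷ x xs with does (P? x)
  ... | true  = refl
  ... | false = refl

  count≡sum : ∀ xs → count P? xs ≡ sum (map (𝟙 ∘ P?) xs)
  count≡sum []       = refl
  count≡sum (x ∷ xs) = trans (count-∷ x xs) (cong (𝟙 (P? x) +_) (count≡sum xs))

  count-++ : ∀ xs ys → count P? (xs ++ ys) ≡ count P? xs + count P? ys
  count-++ xs ys = trans (cong length (filter-++ P? xs ys)) (length-++ (filter P? xs))

  count-map : ∀ (f : B → A) xs → count P? (map f xs) ≡ count (P? ∘ f) xs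
  count-map f []       = refl
  count-map f (x ∷ xs) with does (P? (f x))
  ... | true  = cong suc (count-map f xs)
  ... | false = count-map f xs

  count-none : (∀ x → ¬ P x) → ∀ xs → count P? xs ≡ 0
  count-none ¬P xs = cong length (filter-none P? (universal ¬P xs))

  count-≐ : {Q : Pred A 0ℓ} (Q? : Decidable Q) → P ≐ Q → ∀ xs → count P? xs ≡ count Q? xs
  count-≐ Q? P≐Q xs = cong length (filter-≐ P? Q? P≐Q xs)

  count-split : {Q R : Pred A 0ℓ} (Q? : Decidable Q) (R? : Decidable R) →
    (∀ {x} → Q x → P x) → (∀ {x} → R x → P x) →
    (∀ {x} → P x → Q x ⊎ R x) → (∀ {x} → Q x → ¬ R x) →
    ∀ xs → count P? xs ≡ count Q? xs + count R? xs
  count-split Q? R? Q⇒P R⇒P P⇒Q⊎R Q⇒¬R []       = refl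
  count-split Q? R? Q⇒P R⇒P P⇒Q⊎R Q⇒¬R (x ∷ xs)
    with ih ← count-split Q? R? Q⇒P R⇒P P⇒Q⊎R Q⇒¬R xs | P? x | Q? x | R? x
  ... | _     | yes q | yes r = contradiction r (Q⇒¬R q)
  ... | yes _ | yes _ | no _  = cong suc ih
  ... | yes _ | no _  | yes _ = trans (cong suc ih) (sym (+-suc _ _))
  ... | yes p | no ¬q | no ¬r = contradiction (P⇒Q⊎R p) Sum.[ ¬q , ¬r ]
  ... | no ¬p | yes q | no _  = contradiction (Q⇒P q) ¬p
  ... | no ¬p | no _  | yes r = contradiction (R⇒P r) ¬p
  ... | no _  | no _  | no _  = ih

  0<count : ∀ {x xs} → x List.∈ xs → P x → 1 ≤ count P? xs
  0<count x∈xs px = ∈-length (∈-filter⁺ P? x∈xs px)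

  count≤1⁻ : ∀ {x y xs} → count P? xs ≤ 1 → x List.∈ xs → y List.∈ xs → P x → P y → x ≡ y
  count≤1⁻ {xs = xs} c≤1 x∈ y∈ px py =
    go (filter P? xs) c≤1 (∈-filter⁺ P? x∈ px) (∈-filter⁺ P? y∈ py)
    where
    go : ∀ {x y} zs → length zs ≤ 1 → x List.∈ zs → y List.∈ zs → x ≡ y
    go (_ ∷ [])    _        (here refl) (here refl) = refl
    go (_ ∷ _ ∷ _) (s≤s ()) _           _

  count≤1⁺ : (∀ {x y} → P x → P y → x ≡ y) → ∀ {xs} → Unique xs → count P? xs ≤ 1
  count≤1⁺ P-unique {xs} xs! = go (Unique.filter⁺ P? xs!) (proj₂ ∘ ∈-filter⁻ P? {xs = xs})
    where
    go : ∀ {zs} → Unique zs → (∀ {z} → z List.∈ zs → P z) → length zs ≤ 1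
    go []                  _   = z≤n
    go ([] ∷ [])           _   = s≤s z≤n
    go ((x≢y ∷ _) ∷ _ ∷ _) all =
      contradiction (P-unique (all (here refl)) (all (there (here refl)))) x≢y

sum-map-+ : ∀ (f g : A → ℕ) xs →
  sum (map (λ x → f x + g x) xs) ≡ sum (map f xs) + sum (map g xs)
sum-map-+ f g []       = refl
sum-map-+ f g (x ∷ xs) =
  trans (cong (f x + g x +_) (sum-map-+ f g xs)) (interchange (f x) (g x) _ _)

sum-map-const : ∀ {f : A → ℕ} {c} → (∀ x → f x ≡ c) → ∀ xs → sum (map f xs) ≡ length xs * c
sum-map-const f≡c []       = refl
sum-map-const f≡c (x ∷ xs) = cong₂ _+_ (f≡c x) (sum-map-const f≡c xs)

sum-map-mono : ∀ {f g : A → ℕ} → (∀ x → f x ≤ g x) → ∀ xs → sum (map f xs) ≤ sum (map g xs)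
sum-map-mono f≤g []       = z≤n
sum-map-mono f≤g (x ∷ xs) = +-mono-≤ (f≤g x) (sum-map-mono f≤g xs)

-- A termwise inequality with equal totals leaves no slack in any term. This turns the equality for
-- k₃ into a statement about each single subset.
sum-map-≡⇒≡ : ∀ {f g : A → ℕ} → (∀ x → f x ≤ g x) → ∀ {xs} →
  sum (map f xs) ≡ sum (map g xs) → ∀ {x} → x List.∈ xs → f x ≡ g x
sum-map-≡⇒≡ {f = f} {g} f≤g {y ∷ ys} eq = λ where
    (here refl)  → fy≡gy
    (there x∈ys) → sum-map-≡⇒≡ f≤g tails x∈ys
  where
  gy≤fy : g y ≤ f y
  gy≤fy = +-cancelʳ-≤ (sum (map f ys)) (g y) (f y)
    (≤-trans (+-monoʳ-≤ (g y) (sum-map-mono f≤g ys)) (≤-reflexive (sym eq)))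

  fy≡gy : f y ≡ g y
  fy≡gy = ≤-antisym (f≤g y) gy≤fy

  tails : sum (map f ys) ≡ sum (map g ys)
  tails = +-cancelˡ-≡ (g y) _ _ (trans (cong (_+ sum (map f ys)) (sym fy≡gy)) eq)

-- Both sides count the related pairs, once by rows and once by columns. The induction splits off
-- one row as a sum of indicators.
double-counting : {R : A → B → Set} (R? : ∀ x y → Dec (R x y)) (xs : List A) (ys : List B) →
  sum (map (λ x → count (R? x) ys) xs) ≡ sum (map (λ y → count (λ x → R? x y) xs) ys)
double-counting R? []       ys =
  sym (trans (sum-map-const (λ _ → refl) ys) (*-zeroʳ (length ys)))
double-counting R? (x ∷ xs) ys = begin
  count (R? x) ys + sum (map (λ x′ → count (R? x′) ys) xs)
    ≡⟨ cong₂ _+_ (count≡sum (R? x) ys) (double-counting R? xs ys) ⟩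
  sum (map (λ y → 𝟙 (R? x y)) ys) + sum (map (λ y → count (λ x′ → R? x′ y) xs) ys)
    ≡⟨ sum-map-+ (λ y → 𝟙 (R? x y)) _ ys ⟨
  sum (map (λ y → 𝟙 (R? x y) + count (λ x′ → R? x′ y) xs) ys)
    ≡⟨ cong sum (map-cong (λ y → count-∷ (λ x′ → R? x′ y) x xs) ys) ⟨
  sum (map (λ y → count (λ x′ → R? x′ y) (x ∷ xs)) ys) ∎
  where open ≡-Reasoning

-- Subsets of a finite set

∈-subsets : (S : Subset n) → S List.∈ subsets n
∈-subsets []            = here refl
∈-subsets (inside  ∷ S) = ∈-++⁺ˡ (∈-map⁺ (inside ∷_) (∈-subsets S))
∈-subsets (outside ∷ S) = ∈-++⁺ʳ _ (∈-map⁺ (outside ∷_) (∈-subsets S))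

x∉p⇒∣p∪⁅x⁆∣≡1+∣p∣ : ∀ {p : Subset n} {x} → x ∉ p → ∣ p ∪ ⁅ x ⁆ ∣ ≡ suc ∣ p ∣
x∉p⇒∣p∪⁅x⁆∣≡1+∣p∣ {p = inside  ∷ p} {zero}  x∉p = contradiction here x∉p
x∉p⇒∣p∪⁅x⁆∣≡1+∣p∣ {p = outside ∷ p} {zero}  x∉p = cong (suc ∘ ∣_∣) (∪-identityʳ p)
x∉p⇒∣p∪⁅x⁆∣≡1+∣p∣ {p = inside  ∷ p} {suc x} x∉p = cong suc (x∉p⇒∣p∪⁅x⁆∣≡1+∣p∣ (x∉p ∘ there))
x∉p⇒∣p∪⁅x⁆∣≡1+∣p∣ {p = outside ∷ p} {suc x} x∉p = x∉p⇒∣p∪⁅x⁆∣≡1+∣p∣ (x∉p ∘ there)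

x∈p⇒1+∣p-x∣≡∣p∣ : ∀ {p : Subset n} {x} → x ∈ p → suc ∣ p - x ∣ ≡ ∣ p ∣
x∈p⇒1+∣p-x∣≡∣p∣ {p = inside  ∷ p} here        = cong (suc ∘ ∣_∣) (p─⊥≡p p)
x∈p⇒1+∣p-x∣≡∣p∣ {p = inside  ∷ p} (there x∈p) = cong suc (x∈p⇒1+∣p-x∣≡∣p∣ x∈p)
x∈p⇒1+∣p-x∣≡∣p∣ {p = outside ∷ p} (there x∈p) = x∈p⇒1+∣p-x∣≡∣p∣ x∈p

∣p∣≡1+k⇒∣p-x∣≡k : ∀ {p : Subset n} {x k} → ∣ p ∣ ≡ suc k → x ∈ p → ∣ p - x ∣ ≡ k
∣p∣≡1+k⇒∣p-x∣≡k ∣p∣≡1+k x∈p = suc-injective (trans (x∈p⇒1+∣p-x∣≡∣p∣ x∈p) ∣p∣≡1+k)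

∣p∣≡1+k⇒∃∈ : ∀ {p : Subset n} {k} → ∣ p ∣ ≡ suc k → ∃ (_∈ p)
∣p∣≡1+k⇒∃∈ {p = inside  ∷ p} _  = zero , here
∣p∣≡1+k⇒∃∈ {p = outside ∷ p} eq with x , x∈p ← ∣p∣≡1+k⇒∃∈ {p = p} eq = suc x , there x∈p

∣p∣≡0⇒∉ : ∀ {p : Subset n} {x} → ∣ p ∣ ≡ 0 → x ∉ p
∣p∣≡0⇒∉ ∣p∣≡0 x∈p = 1+n≢0 (trans (x∈p⇒1+∣p-x∣≡∣p∣ x∈p) ∣p∣≡0)

x∉p-x : ∀ (p : Subset n) x → x ∉ p - x
x∉p-x (_ ∷ p) (suc x) (there x∈) = x∉p-x p x x∈

x∈p-y⁻ : ∀ (p : Subset n) {x} y → x ∈ p - y → x ∈ p × x ≢ y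
x∈p-y⁻ p y x∈ = p─q⊆p p ⁅ y ⁆ x∈ , λ { refl → x∉p-x p y x∈ }

p⊆q∧∣p∣≡∣q∣⇒p≡q : ∀ {p q : Subset n} → p ⊆ q → ∣ p ∣ ≡ ∣ q ∣ → p ≡ q
p⊆q∧∣p∣≡∣q∣⇒p≡q {p = p} {q} p⊆q ∣p∣≡∣q∣ = ⊆-antisym p⊆q q⊆p
  where
  q⊆p : q ⊆ p
  q⊆p {x} x∈q with x ∈? p
  ... | yes x∈p = x∈p
  ... | no  x∉p = contradiction ∣p∣≡∣q∣ (<⇒≢ (p⊂q⇒∣p∣<∣q∣ (p⊆q , x , x∈q , x∉p)))

-- Naming the elements reduces connectivity on three points to a case analysis over the possible
-- edges.
record ThreeElements {n} (S : Subset n) : Set where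
  field
    {a b c}    : Fin n
    a∈S        : a ∈ S
    b∈S        : b ∈ S
    c∈S        : c ∈ S
    b≢a        : b ≢ a
    c≢a        : c ≢ a
    c≢b        : c ≢ b
    exhaustive : ∀ {x} → x ∈ S → x ≡ a ⊎ x ≡ b ⊎ x ≡ c

∣S∣≡3⇒threeElements : ∀ {S : Subset n} → ∣ S ∣ ≡ 3 → ThreeElements S
∣S∣≡3⇒threeElements {S = S} ∣S∣≡3
  with a , a∈S ← ∣p∣≡1+k⇒∃∈ {p = S} ∣S∣≡3
  with ∣S-a∣≡2 ← ∣p∣≡1+k⇒∣p-x∣≡k ∣S∣≡3 a∈S
  with b , b∈S-a ← ∣p∣≡1+k⇒∃∈ {p = S - a} ∣S-a∣≡2
  with ∣S-a-b∣≡1 ← ∣p∣≡1+k⇒∣p-x∣≡k ∣S-a∣≡2 b∈S-a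
  with c , c∈S-a-b ← ∣p∣≡1+k⇒∃∈ {p = S - a - b} ∣S-a-b∣≡1
  with ∣S-a-b-c∣≡0 ← ∣p∣≡1+k⇒∣p-x∣≡k ∣S-a-b∣≡1 c∈S-a-b
  with b∈S , b≢a ← x∈p-y⁻ S a b∈S-a
  with c∈S-a , c≢b ← x∈p-y⁻ (S - a) b c∈S-a-b
  with c∈S , c≢a ← x∈p-y⁻ S a c∈S-a
  = record
    { a∈S = a∈S ; b∈S = b∈S ; c∈S = c∈S
    ; b≢a = b≢a ; c≢a = c≢a ; c≢b = c≢b
    ; exhaustive = λ {x} x∈S → exhaustive x x∈S
    }
  where
  exhaustive : ∀ x → x ∈ S → x ≡ a ⊎ x ≡ b ⊎ x ≡ c
  exhaustive x x∈S with x Fin.≟ a | x Fin.≟ b | x Fin.≟ c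
  ... | yes x≡a | _       | _       = inj₁ x≡a
  ... | no _    | yes x≡b | _       = inj₂ (inj₁ x≡b)
  ... | no _    | no _    | yes x≡c = inj₂ (inj₂ x≡c)
  -- A fourth element would survive the three deletions, which leave a set of size 0.
  ... | no x≢a  | no x≢b  | no x≢c  = contradiction
    (x∈p∧x≢y⇒x∈p-y (x∈p∧x≢y⇒x∈p-y (x∈p∧x≢y⇒x∈p-y x∈S x≢a) x≢b) x≢c)
    (∣p∣≡0⇒∉ ∣S-a-b-c∣≡0)

-- Split by membership of the first point. The sets avoiding it are counted by the recursion at `k`;
-- sets containing it exist only if it lies in `T` and `k` is positive, and are then counted by the
-- recursion at the predecessor of `k`. Pascal's rule adds the two.
count-⊆ : ∀ k (T : Subset n) →
  count (λ S → (∣ S ∣ ≟ k) ×-dec (S ⊆? T)) (subsets n) ≡ ∣ T ∣ C k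
count-⊆ zero    []        = refl
count-⊆ (suc k) []        = refl
count-⊆ {suc n} k (t ∷ T) = begin
  count Q? (map (inside ∷_) (subsets n) ++ map (outside ∷_) (subsets n))
    ≡⟨ count-++ Q? (map (inside ∷_) (subsets n)) _ ⟩
  count Q? (map (inside ∷_) (subsets n)) + count Q? (map (outside ∷_) (subsets n))
    ≡⟨ cong₂ _+_ (count-map Q? (inside ∷_) (subsets n)) (count-map Q? (outside ∷_) (subsets n)) ⟩
  count (Q? ∘ (inside ∷_)) (subsets n) + count (Q? ∘ (outside ∷_)) (subsets n)
    ≡⟨ cong (count (Q? ∘ (inside ∷_)) (subsets n) +_) without ⟩
  count (Q? ∘ (inside ∷_)) (subsets n) + ∣ T ∣ C k
    ≡⟨ pascal t k ⟩
  ∣ t ∷ T ∣ C k ∎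
  where
  open ≡-Reasoning

  Q? : Decidable (λ S → ∣ S ∣ ≡ k × S ⊆ t ∷ T)
  Q? S = (∣ S ∣ ≟ k) ×-dec (S ⊆? (t ∷ T))

  without : count (Q? ∘ (outside ∷_)) (subsets n) ≡ ∣ T ∣ C k
  without = trans
    (count-≐ (Q? ∘ (outside ∷_)) (λ S → (∣ S ∣ ≟ k) ×-dec (S ⊆? T))
      ((λ (eq , S⊆) → eq , drop-∷-⊆ S⊆) , (λ (eq , S⊆) → eq , out⊆ S⊆)) (subsets n))
    (count-⊆ k T)

  -- This is `Q? ∘ (inside ∷_)` with `t` and `k` turned into arguments, so that `pascal` can match
  -- on them.
  with? : ∀ t k → Decidable (λ S → suc ∣ S ∣ ≡ k × inside ∷ S ⊆ t ∷ T)
  with? t k S = (suc ∣ S ∣ ≟ k) ×-dec ((inside ∷ S) ⊆? (t ∷ T))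

  pascal : ∀ t k → count (with? t k) (subsets n) + ∣ T ∣ C k
      ≡ ∣ t ∷ T ∣ C k
  pascal outside k =
    cong (_+ ∣ T ∣ C k) (count-none (with? outside k) (λ _ (_ , S⊆) → case S⊆ here of λ ()) (subsets n))
  pascal inside zero =
    cong (_+ ∣ T ∣ C 0) (count-none (with? inside 0) (λ _ (eq , _) → 1+n≢0 eq) (subsets n))
  pascal inside (suc k) = trans
    (cong (_+ ∣ T ∣ C suc k) (trans
      (count-≐ (with? inside (suc k)) (λ S → (∣ S ∣ ≟ k) ×-dec (S ⊆? T))
        ( (λ (eq , S⊆) → suc-injective eq , drop-∷-⊆ S⊆)
        , (λ (eq , S⊆) → cong suc eq , in⊆in S⊆)) (subsets n))
      (count-⊆ k T)))
    (nCk+nC[k+1]≡[n+1]C[k+1] ∣ T ∣ k)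

-- A subset of p ∪ ⁅ x ⁆ contains x or lies in p, so Pascal's rule gives the count.
count-⊆-∋ : ∀ k {p : Subset n} {x} → x ∉ p →
  count (λ S → (x ∈? S) ×-dec ((∣ S ∣ ≟ suc k) ×-dec (S ⊆? (p ∪ ⁅ x ⁆)))) (subsets n) ≡ ∣ p ∣ C k
count-⊆-∋ {n} k {p} {x} x∉p = +-cancelʳ-≡ (∣ p ∣ C suc k) _ _ (begin
  count Q? (subsets n) + ∣ p ∣ C suc k
    ≡⟨ cong (count Q? (subsets n) +_) (count-⊆ (suc k) p) ⟨
  count Q? (subsets n) + count R? (subsets n)
    ≡⟨ count-split P? Q? R? proj₂ R⇒P P⇒Q⊎R (λ (x∈S , _) (_ , S⊆p) → x∉p (S⊆p x∈S)) (subsets n) ⟨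
  count P? (subsets n)
    ≡⟨ count-⊆ (suc k) (p ∪ ⁅ x ⁆) ⟩
  ∣ p ∪ ⁅ x ⁆ ∣ C suc k
    ≡⟨ cong (_C suc k) (x∉p⇒∣p∪⁅x⁆∣≡1+∣p∣ x∉p) ⟩
  suc ∣ p ∣ C suc k
    ≡⟨ nCk+nC[k+1]≡[n+1]C[k+1] ∣ p ∣ k ⟨
  ∣ p ∣ C k + ∣ p ∣ C suc k ∎)
  where
  open ≡-Reasoning

  P? : Decidable (λ S → ∣ S ∣ ≡ suc k × S ⊆ p ∪ ⁅ x ⁆)
  P? S = (∣ S ∣ ≟ suc k) ×-dec (S ⊆? (p ∪ ⁅ x ⁆))

  Q? : Decidable (λ S → x ∈ S × ∣ S ∣ ≡ suc k × S ⊆ p ∪ ⁅ x ⁆)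
  Q? S = (x ∈? S) ×-dec P? S

  R? : Decidable (λ S → ∣ S ∣ ≡ suc k × S ⊆ p)
  R? S = (∣ S ∣ ≟ suc k) ×-dec (S ⊆? p)

  R⇒P : ∀ {S} → ∣ S ∣ ≡ suc k × S ⊆ p → ∣ S ∣ ≡ suc k × S ⊆ p ∪ ⁅ x ⁆
  R⇒P (eq , S⊆p) = eq , λ y∈S → p⊆p∪q ⁅ x ⁆ (S⊆p y∈S)

  P⇒Q⊎R : ∀ {S} → ∣ S ∣ ≡ suc k × S ⊆ p ∪ ⁅ x ⁆ →
    (x ∈ S × ∣ S ∣ ≡ suc k × S ⊆ p ∪ ⁅ x ⁆) ⊎ (∣ S ∣ ≡ suc k × S ⊆ p)
  P⇒Q⊎R {S} (eq , S⊆) with x ∈? S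
  ... | yes x∈S = inj₁ (x∈S , eq , S⊆)
  ... | no  x∉S = inj₂ (eq , S⊆p)
    where
    S⊆p : S ⊆ p
    S⊆p y∈S with x∈p∪q⁻ p ⁅ x ⁆ (S⊆ y∈S)
    ... | inj₁ y∈p   = y∈p
    ... | inj₂ y∈⁅x⁆ with refl ← x∈⁅y⁆⇒x≡y x y∈⁅x⁆ = contradiction y∈S x∉S

-- Subsets given by decidable predicates, and the partition along a subset

∣tabulate∣ : ∀ {P : Pred A 0ℓ} (P? : Decidable P) (f : Fin n → A) →
  ∣ Vec.tabulate (does ∘ P? ∘ f) ∣ ≡ count P? (List.tabulate f)
∣tabulate∣ {n = zero}  P? f = refl
∣tabulate∣ {n = suc n} P? f with does (P? (f zero))
... | true  = cong suc (∣tabulate∣ P? (f ∘ suc))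
... | false = ∣tabulate∣ P? (f ∘ suc)

module _ {P : Pred (Fin n) 0ℓ} (P? : Decidable P) {x : Fin n} where

  ∈-tabulate⁺ : P x → x ∈ Vec.tabulate (does ∘ P?)
  ∈-tabulate⁺ px = lookup⇒[]= x _ (trans (lookup∘tabulate (does ∘ P?) x) (dec-true (P? x) px))

  ∈-tabulate⁻ : x ∈ Vec.tabulate (does ∘ P?) → P x
  ∈-tabulate⁻ x∈ = true-dec (P? x) (trans (sym (lookup∘tabulate (does ∘ P?) x)) ([]=⇒lookup x∈))
    where
    true-dec : ∀ (d : Dec (P x)) → does d ≡ true → P x
    true-dec (yes px) _ = px

-- The rank of a point within `A` or within its complement. With `unside` as inverse it becomes the
-- vertex bijection onto a complete bipartite graph.
side : (A : Subset n) → Fin n → Fin ∣ A ∣ ⊎ Fin ∣ ∁ A ∣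
side (inside  ∷ A) zero    = inj₁ zero
side (outside ∷ A) zero    = inj₂ zero
side (inside  ∷ A) (suc x) = Sum.map₁ suc (side A x)
side (outside ∷ A) (suc x) = Sum.map₂ suc (side A x)

unside : (A : Subset n) → Fin ∣ A ∣ ⊎ Fin ∣ ∁ A ∣ → Fin n
unside (inside  ∷ A) (inj₁ zero)    = zero
unside (inside  ∷ A) (inj₁ (suc i)) = suc (unside A (inj₁ i))
unside (inside  ∷ A) (inj₂ j)       = suc (unside A (inj₂ j))
unside (outside ∷ A) (inj₁ i)       = suc (unside A (inj₁ i))
unside (outside ∷ A) (inj₂ zero)    = zero
unside (outside ∷ A) (inj₂ (suc j)) = suc (unside A (inj₂ j))

side-unside : (A : Subset n) → ∀ y → side A (unside A y) ≡ y
side-unside (inside  ∷ A) (inj₁ zero)    = refl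
side-unside (inside  ∷ A) (inj₁ (suc i)) = cong (Sum.map₁ suc) (side-unside A (inj₁ i))
side-unside (inside  ∷ A) (inj₂ j)       = cong (Sum.map₁ suc) (side-unside A (inj₂ j))
side-unside (outside ∷ A) (inj₁ i)       = cong (Sum.map₂ suc) (side-unside A (inj₁ i))
side-unside (outside ∷ A) (inj₂ zero)    = refl
side-unside (outside ∷ A) (inj₂ (suc j)) = cong (Sum.map₂ suc) (side-unside A (inj₂ j))

unside-side : (A : Subset n) → ∀ x → unside A (side A x) ≡ x
unside-side (inside  ∷ A) zero    = refl
unside-side (outside ∷ A) zero    = refl
unside-side (inside  ∷ A) (suc x) with side A x | unside-side A x
... | inj₁ _ | eq = cong suc eq
... | inj₂ _ | eq = cong suc eq
unside-side (outside ∷ A) (suc x) with side A x | unside-side A x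
... | inj₁ _ | eq = cong suc eq
... | inj₂ _ | eq = cong suc eq

side-∈ : ∀ {A : Subset n} {x} → x ∈ A → ∃ λ i → side A x ≡ inj₁ i
side-∈ {A = inside  ∷ A} here = zero , refl
side-∈ {A = inside  ∷ A} (there x∈A) with i , eq ← side-∈ x∈A = suc i , cong (Sum.map₁ suc) eq
side-∈ {A = outside ∷ A} (there x∈A) with i , eq ← side-∈ x∈A = i , cong (Sum.map₂ suc) eq

side-∉ : ∀ {A : Subset n} {x} → x ∉ A → ∃ λ j → side A x ≡ inj₂ j
side-∉ {A = inside  ∷ A} {zero}  x∉A = contradiction here x∉A
side-∉ {A = outside ∷ A} {zero}  x∉A = zero , refl
side-∉ {A = inside  ∷ A} {suc x} x∉A with j , eq ← side-∉ (x∉A ∘ there) = j , cong (Sum.map₁ suc) eq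
side-∉ {A = outside ∷ A} {suc x} x∉A with j , eq ← side-∉ (x∉A ∘ there) = suc j , cong (Sum.map₂ suc) eq

-- Graphs

-- The three adjacencies already force x, y and z to be distinct, since adjacency is irreflexive.
TriangleFree : {V : Set} → SimpleGraph V → Set
TriangleFree G = ∀ {x y z} → Adj x y → Adj y z → ¬ Adj x z
  where open SimpleGraph G

≅-triangleFree : {V W : Set} {G : SimpleGraph V} {H : SimpleGraph W} →
  G ≅ H → TriangleFree H → TriangleFree G
≅-triangleFree G≅H H-free {x} {y} {z} x~y y~z x~z =
  H-free (to (adjacency x y) x~y) (to (adjacency y z) y~z) (to (adjacency x z) x~z)
  where
  open _≅_ G≅H
  open Equivalence

-- Every edge changes sides, so two edges lead back to the side of x, where z cannot be adjacent to
-- x.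
completeBipartite-triangleFree : ∀ m n → TriangleFree (completeBipartite m n)
completeBipartite-triangleFree m n {inj₁ _} {inj₂ _} {inj₁ _} _ _ ()
completeBipartite-triangleFree m n {inj₂ _} {inj₁ _} {inj₂ _} _ _ ()

-- Neighbourhoods and centres

module _ {n} (G : SimpleGraph (Fin n)) where

  open SimpleGraph G renaming (sym to ~-sym)

  N : Fin n → Subset n
  N v = Vec.tabulate (does ∘ adj? v)

  ∣N∣≡degree : ∀ v → ∣ N v ∣ ≡ degree G v
  -- `allFin n` is `List.tabulate` of the identity; `∣tabulate∣` takes a general function because
  -- its induction passes to `f ∘ suc`.
  ∣N∣≡degree v = ∣tabulate∣ (adj? v) (λ x → x)

  -- `N v ∪ ⁅ v ⁆` is the closed neighbourhood, so v is adjacent to all other elements of S. The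
  -- conjuncts follow the shape of `count-⊆-∋`, which therefore counts the sets centred at v
  -- directly.
  Centre : ℕ → Subset n → Fin n → Set
  Centre k S v = v ∈ S × ∣ S ∣ ≡ k × S ⊆ N v ∪ ⁅ v ⁆

  centre? : ∀ k S → Decidable (Centre k S)
  centre? k S v = (v ∈? S) ×-dec ((∣ S ∣ ≟ k) ×-dec (S ⊆? (N v ∪ ⁅ v ⁆)))

  centre⁺ : ∀ {k S v} → v ∈ S → ∣ S ∣ ≡ k → (∀ {x} → x ∈ S → x ≡ v ⊎ Adj v x) → Centre k S v
  centre⁺ {k} {S} {v} v∈S ∣S∣≡k S⇒ = v∈S , ∣S∣≡k , S⊆
    where
    S⊆ : S ⊆ N v ∪ ⁅ v ⁆
    S⊆ x∈S with S⇒ x∈S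
    ... | inj₁ refl = q⊆p∪q (N v) ⁅ v ⁆ (x∈⁅x⁆ v)
    ... | inj₂ v~x  = p⊆p∪q ⁅ v ⁆ (∈-tabulate⁺ (adj? v) v~x)

  centre⁻ : ∀ {k S v} → Centre k S v → ∀ {x} → x ∈ S → x ≡ v ⊎ Adj v x
  centre⁻ {v = v} (_ , _ , S⊆) x∈S with x∈p∪q⁻ (N v) ⁅ v ⁆ (S⊆ x∈S)
  ... | inj₁ x∈N = inj₂ (∈-tabulate⁻ (adj? v) x∈N)
  ... | inj₂ x∈v = inj₁ (x∈⁅y⁆⇒x≡y v x∈v)

  -- Such a set consists of v and k of its neighbours; irreflexivity keeps v itself out of `N v`.
  count-centre : ∀ k v → count (λ S → centre? (suc k) S v) (subsets n) ≡ degree G v C k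
  count-centre k v =
    trans (count-⊆-∋ k (irrefl refl ∘ ∈-tabulate⁻ (adj? v))) (cong (_C k) (∣N∣≡degree v))

  ConnectedOfSize : ℕ → Subset n → Set
  ConnectedOfSize k S = ∣ S ∣ ≡ k × Connected (induced G S)

  connectedOfSize? : ∀ k → Decidable (ConnectedOfSize k)
  connectedOfSize? k S = (∣ S ∣ ≟ k) ×-dec inducedConnected? G S

  -- Any two elements are joined by a walk through the centre.
  centre⇒connected : ∀ {k S v} → Centre k S v → ConnectedOfSize k S
  centre⇒connected {S = S} {v} c@(v∈S , ∣S∣≡k , _) = ∣S∣≡k , λ x y → toCentre x ◅◅ fromCentre y
    where
    toCentre : ∀ x → Star (SimpleGraph.Adj (induced G S)) x (v , v∈S)
    toCentre (x , x∈S) with centre⁻ c x∈S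
    -- Vertices of the induced graph carry membership proofs, which must be identified before the
    -- empty walk fits.
    ... | inj₁ refl rewrite []=-irrelevant x∈S v∈S = ε
    ... | inj₂ v~x  = ~-sym v~x ◅ ε

    fromCentre : ∀ x → Star (SimpleGraph.Adj (induced G S)) (v , v∈S) x
    fromCentre (x , x∈S) with centre⁻ c x∈S
    ... | inj₁ refl rewrite []=-irrelevant x∈S v∈S = ε
    ... | inj₂ v~x  = v~x ◅ ε

  -- The neighbour is the first step of a walk from x to y, which cannot be empty.
  connected⇒neighbour : ∀ {S} → Connected (induced G S) → ∀ {x y} → x ∈ S → y ∈ S → x ≢ y →
    ∃ λ z → z ∈ S × Adj x z
  connected⇒neighbour conn {x} {y} x∈S y∈S x≢y with conn (x , x∈S) (y , y∈S)
  ... | ε                       = contradiction refl x≢y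
  ... | _◅_ {j = z , z∈S} x~z _ = z , z∈S , x~z

  -- Each of the three elements has a neighbour among the other two. A single edge would miss one of
  -- them, so there are two edges, and two edges on three points share an endpoint, the centre.
  connected⇒centre : ∀ {S} → ConnectedOfSize 3 S → ∃ (Centre 3 S)
  connected⇒centre {S} (∣S∣≡3 , conn) =
    pick (neighbour a∈S b∈S (≢-sym b≢a)) (neighbour b∈S a∈S b≢a) (neighbour c∈S a∈S c≢a)
    where
    open ThreeElements (∣S∣≡3⇒threeElements {S = S} ∣S∣≡3)

    neighbour : ∀ {x y} → x ∈ S → y ∈ S → x ≢ y → Adj x a ⊎ Adj x b ⊎ Adj x c
    neighbour x∈S y∈S x≢y with z , z∈S , x~z ← connected⇒neighbour conn x∈S y∈S x≢y with exhaustive z∈S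
    ... | inj₁ refl        = inj₁ x~z
    ... | inj₂ (inj₁ refl) = inj₂ (inj₁ x~z)
    ... | inj₂ (inj₂ refl) = inj₂ (inj₂ x~z)

    centre-a : Adj a b → Adj a c → ∃ (Centre 3 S)
    centre-a a~b a~c = a , centre⁺ a∈S ∣S∣≡3 λ x∈S → case exhaustive x∈S of λ where
      (inj₁ x≡a)         → inj₁ x≡a
      (inj₂ (inj₁ refl)) → inj₂ a~b
      (inj₂ (inj₂ refl)) → inj₂ a~c

    centre-b : Adj b a → Adj b c → ∃ (Centre 3 S)
    centre-b b~a b~c = b , centre⁺ b∈S ∣S∣≡3 λ x∈S → case exhaustive x∈S of λ where
      (inj₁ refl)        → inj₂ b~a
      (inj₂ (inj₁ x≡b))  → inj₁ x≡b
      (inj₂ (inj₂ refl)) → inj₂ b~c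

    centre-c : Adj c a → Adj c b → ∃ (Centre 3 S)
    centre-c c~a c~b = c , centre⁺ c∈S ∣S∣≡3 λ x∈S → case exhaustive x∈S of λ where
      (inj₁ refl)        → inj₂ c~a
      (inj₂ (inj₁ refl)) → inj₂ c~b
      (inj₂ (inj₂ x≡c))  → inj₁ x≡c

    pick : Adj a a ⊎ Adj a b ⊎ Adj a c → Adj b a ⊎ Adj b b ⊎ Adj b c →
      Adj c a ⊎ Adj c b ⊎ Adj c c → ∃ (Centre 3 S)
    pick (inj₁ a~a) _ _ = contradiction a~a (irrefl refl)
    pick _ (inj₂ (inj₁ b~b)) _ = contradiction b~b (irrefl refl)
    pick _ _ (inj₂ (inj₂ c~c)) = contradiction c~c (irrefl refl)
    -- With loops excluded, the edge chosen at a and the edge chosen at the vertex that a did not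
    -- choose are distinct; their common endpoint is the centre.
    pick (inj₂ (inj₁ a~b)) _ (inj₁ c~a) = centre-a a~b (~-sym c~a)
    pick (inj₂ (inj₁ a~b)) _ (inj₂ (inj₁ c~b)) = centre-b (~-sym a~b) (~-sym c~b)
    pick (inj₂ (inj₂ a~c)) (inj₁ b~a) _ = centre-a (~-sym b~a) a~c
    pick (inj₂ (inj₂ a~c)) (inj₂ (inj₂ b~c)) _ = centre-c (~-sym a~c) (~-sym b~c)

  -- Two distinct centres are adjacent to each other and both to the third element of S, which makes
  -- a triangle.
  triangleFree⇒centre-unique : TriangleFree G → ∀ {S v w} → Centre 3 S v → Centre 3 S w → v ≡ w
  triangleFree⇒centre-unique free {S} {v} {w} cv@(v∈S , ∣S∣≡3 , _) cw@(w∈S , _) with v Fin.≟ w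
  ... | yes v≡w = v≡w
  ... | no  v≢w
    with ∣S-v∣≡2 ← ∣p∣≡1+k⇒∣p-x∣≡k ∣S∣≡3 v∈S
    with ∣S-v-w∣≡1 ← ∣p∣≡1+k⇒∣p-x∣≡k ∣S-v∣≡2 (x∈p∧x≢y⇒x∈p-y w∈S (≢-sym v≢w))
    with x , x∈S-v-w ← ∣p∣≡1+k⇒∃∈ {p = S - v - w} ∣S-v-w∣≡1
    with x∈S-v , x≢w ← x∈p-y⁻ (S - v) w x∈S-v-w
    with x∈S , x≢v ← x∈p-y⁻ S v x∈S-v
    = contradiction (adjacent cv x∈S x≢v) (free (adjacent cv w∈S (≢-sym v≢w)) (adjacent cw x∈S x≢w))
    where
    adjacent : ∀ {u y} → Centre 3 S u → y ∈ S → y ≢ u → Adj u y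
    adjacent cu y∈S y≢u = Sum.[ (λ y≡u → contradiction y≡u y≢u) , (λ u~y → u~y) ] (centre⁻ cu y∈S)

  -- In a triangle all vertices are centres of the same set, so uniqueness would identify the
  -- adjacent vertices x and y.
  centre-unique⇒triangleFree : (∀ {S v w} → Centre 3 S v → Centre 3 S w → v ≡ w) → TriangleFree G
  centre-unique⇒triangleFree unique {x} {y} {z} x~y y~z x~z =
    irrefl (unique (centre⁺ x∈S ∣S∣≡3 from-x) (centre⁺ y∈S ∣S∣≡3 from-y)) x~y
    where
    S : Subset n
    S = (⁅ x ⁆ ∪ ⁅ y ⁆) ∪ ⁅ z ⁆

    x∈S : x ∈ S
    x∈S = p⊆p∪q ⁅ z ⁆ (p⊆p∪q ⁅ y ⁆ (x∈⁅x⁆ x))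

    y∈S : y ∈ S
    y∈S = p⊆p∪q ⁅ z ⁆ (q⊆p∪q ⁅ x ⁆ ⁅ y ⁆ (x∈⁅x⁆ y))

    ∈xy : ∀ {u} → u ∈ ⁅ x ⁆ ∪ ⁅ y ⁆ → u ≡ x ⊎ u ≡ y
    ∈xy = Sum.map (x∈⁅y⁆⇒x≡y x) (x∈⁅y⁆⇒x≡y y) ∘ x∈p∪q⁻ ⁅ x ⁆ ⁅ y ⁆

    ∈xyz : ∀ {u} → u ∈ S → (u ≡ x ⊎ u ≡ y) ⊎ u ≡ z
    ∈xyz = Sum.map ∈xy (x∈⁅y⁆⇒x≡y z) ∘ x∈p∪q⁻ (⁅ x ⁆ ∪ ⁅ y ⁆) ⁅ z ⁆

    y∉ : y ∉ ⁅ x ⁆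
    y∉ y∈ = irrefl (sym (x∈⁅y⁆⇒x≡y x y∈)) x~y

    z∉ : z ∉ ⁅ x ⁆ ∪ ⁅ y ⁆
    z∉ z∈ = Sum.[ (λ z≡x → irrefl (sym z≡x) x~z) , (λ z≡y → irrefl (sym z≡y) y~z) ] (∈xy z∈)

    ∣S∣≡3 : ∣ S ∣ ≡ 3
    ∣S∣≡3 = trans (x∉p⇒∣p∪⁅x⁆∣≡1+∣p∣ z∉)
      (cong suc (trans (x∉p⇒∣p∪⁅x⁆∣≡1+∣p∣ y∉) (cong suc (∣⁅x⁆∣≡1 x))))

    from-x : ∀ {u} → u ∈ S → u ≡ x ⊎ Adj x u
    from-x u∈S with ∈xyz u∈S
    ... | inj₁ (inj₁ u≡x)  = inj₁ u≡x
    ... | inj₁ (inj₂ refl) = inj₂ x~y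
    ... | inj₂ refl        = inj₂ x~z

    from-y : ∀ {u} → u ∈ S → u ≡ y ⊎ Adj y u
    from-y u∈S with ∈xyz u∈S
    ... | inj₁ (inj₁ refl) = inj₂ (~-sym x~y)
    ... | inj₁ (inj₂ u≡y)  = inj₁ u≡y
    ... | inj₂ refl        = inj₂ y~z

  -- Double counting of centres

  centres : Subset n → ℕ
  centres S = count (centre? 3 S) (allFin n)

  -- Pairs of a 3-set and a centre of it are counted by vertex instead of by set; each vertex
  -- contributes `Δ C 2`.
  sum-centres : ∀ {Δ} → Regular Δ G → sum (map centres (subsets n)) ≡ n * (Δ C 2)
  sum-centres {Δ} regular = begin
    sum (map centres (subsets n))
      ≡⟨ double-counting (centre? 3) (subsets n) (allFin n) ⟩
    sum (map (λ v → count (λ S → centre? 3 S v) (subsets n)) (allFin n))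
      ≡⟨ sum-map-const (λ v → trans (count-centre 2 v) (cong (_C 2) (regular v))) (allFin n) ⟩
    length (allFin n) * (Δ C 2)
      ≡⟨ cong (_* (Δ C 2)) (length-tabulate {n = n} (λ x → x)) ⟩
    n * (Δ C 2) ∎
    where open ≡-Reasoning

  -- Summed over all S, this bounds k₃ by the number of pairs of a 3-set and a centre; it holds
  -- because a connected 3-set has a centre.
  𝟙connected≤centres : ∀ S → 𝟙 (connectedOfSize? 3 S) ≤ centres S
  𝟙connected≤centres S = 𝟙≤ (connectedOfSize? 3 S) λ conn →
    0<count (centre? 3 S) (∈-allFin _) (proj₂ (connected⇒centre conn))

  triangleFree⇒𝟙connected≡centres : TriangleFree G → ∀ S → 𝟙 (connectedOfSize? 3 S) ≡ centres S
  triangleFree⇒𝟙connected≡centres free S =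
    ≤-antisym (𝟙connected≤centres S) (≤𝟙 (connectedOfSize? 3 S)
      (λ _ → count≤1⁺ (centre? 3 S) (triangleFree⇒centre-unique free) (Unique.allFin⁺ n))
      (λ ¬conn → count-none (centre? 3 S) (λ _ → ¬conn ∘ centre⇒connected) (allFin n)))

  -- An indicator is at most 1, so no set has two centres.
  𝟙connected≡centres⇒triangleFree : (∀ S → 𝟙 (connectedOfSize? 3 S) ≡ centres S) → TriangleFree G
  𝟙connected≡centres⇒triangleFree eq = centre-unique⇒triangleFree λ {S} {v} {w} →
    count≤1⁻ (centre? 3 S)
      (≤-trans (≤-reflexive (sym (eq S))) (𝟙≤ (connectedOfSize? 3 S) (λ _ → ≤-refl)))
      (∈-allFin v) (∈-allFin w)

  triangleFree⇔count : ∀ {Δ} → Regular Δ G →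
    TriangleFree G ⇔ (connectedSubsets 3 G ≡ n * (Δ C 2))
  triangleFree⇔count {Δ} regular = mk⇔ ⇒ ⇐
    where
    as-sum : connectedSubsets 3 G ≡ sum (map (𝟙 ∘ connectedOfSize? 3) (subsets n))
    as-sum = count≡sum (connectedOfSize? 3) (subsets n)

    ⇒ : TriangleFree G → connectedSubsets 3 G ≡ n * (Δ C 2)
    ⇒ free = trans as-sum (trans
      (cong sum (map-cong (triangleFree⇒𝟙connected≡centres free) (subsets n)))
      (sum-centres regular))

    ⇐ : connectedSubsets 3 G ≡ n * (Δ C 2) → TriangleFree G
    ⇐ eq = 𝟙connected≡centres⇒triangleFree λ S →
      -- k₃ and `n * (Δ C 2)` are the totals of the two sides of `𝟙connected≤centres`, so their
      -- equality forces equality at every S.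
      sum-map-≡⇒≡ 𝟙connected≤centres
        (trans (sym as-sum) (trans eq (sym (sum-centres regular)))) (∈-subsets S)

  -- Recognising the complete bipartite graph

  ≅-completeBipartite : ∀ A → (∀ {x} → x ∈ A → N x ≡ ∁ A) → (∀ {x} → x ∉ A → N x ≡ A) →
    G ≅ completeBipartite ∣ A ∣ ∣ ∁ A ∣
  ≅-completeBipartite A N-∈ N-∉ = record
    { bijection = mk↔ₛ′ (side A) (unside A) (side-unside A) (unside-side A)
    ; adjacency = adjacency
    }
    where
    toN : ∀ {x y p} → N x ≡ p → Adj x y → y ∈ p
    toN {x} refl = ∈-tabulate⁺ (adj? x)

    fromN : ∀ {x y p} → N x ≡ p → y ∈ p → Adj x y
    fromN {x} refl = ∈-tabulate⁻ (adj? x)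

    adjacency : ∀ x y → Adj x y ⇔
      SimpleGraph.Adj (completeBipartite ∣ A ∣ ∣ ∁ A ∣) (side A x) (side A y)
    adjacency x y with x ∈? A | y ∈? A
    -- Once the sides are rewritten, adjacency on the right reduces to `⊥` within a side and to `⊤`
    -- across; across, the forward map is the unique one into `⊤`.
    ... | yes x∈A | yes y∈A rewrite proj₂ (side-∈ x∈A) | proj₂ (side-∈ y∈A) =
      mk⇔ (λ x~y → x∈∁p⇒x∉p (toN (N-∈ x∈A) x~y) y∈A) λ ()
    ... | yes x∈A | no y∉A  rewrite proj₂ (side-∈ x∈A) | proj₂ (side-∉ y∉A) =
      mk⇔ _ (λ _ → fromN (N-∈ x∈A) (x∉p⇒x∈∁p y∉A))
    ... | no x∉A  | yes y∈A rewrite proj₂ (side-∉ x∉A) | proj₂ (side-∈ y∈A) =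
      mk⇔ _ (λ _ → fromN (N-∉ x∉A) y∈A)
    ... | no x∉A  | no y∉A  rewrite proj₂ (side-∉ x∉A) | proj₂ (side-∉ y∉A) =
      mk⇔ (λ x~y → y∉A (toN (N-∉ x∉A) x~y)) λ ()

  -- Fix an edge from u to v and take `N u` as one side. A vertex in `N u` is adjacent to u, so its
  -- neighbourhood is `∁ (N u)`. A vertex outside `N u` lies in `N v`, so its neighbourhood is
  -- `∁ (N v)`, which is `N u`.
  triangleFree⇒≅completeBipartite : ∀ {Δ} → Fin n → Regular Δ G → n ≡ 2 * Δ →
    TriangleFree G → G ≅ completeBipartite Δ Δ
  -- If Δ were 0 there would be no vertex u; a positive Δ gives u a neighbour v.
  triangleFree⇒≅completeBipartite {zero}      u _       n≡0  _    with () ← subst Fin n≡0 u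
  triangleFree⇒≅completeBipartite {Δ@(suc _)} u regular n≡2Δ free
    with v , v∈N ← ∣p∣≡1+k⇒∃∈ {p = N u} (trans (∣N∣≡degree u) (regular u)) =
    subst₂ (λ k l → G ≅ completeBipartite k l) (∣N∣≡Δ u) (∣∁N∣≡Δ u)
      (≅-completeBipartite (N u)
        (λ x∈N → N-∁ (~-sym (∈-tabulate⁻ (adj? u) x∈N)))
        (λ x∉N → trans (N-∁ (~-sym (v~ x∉N))) (sym (N-∁ u~v))))
    where
    ∣N∣≡Δ : ∀ x → ∣ N x ∣ ≡ Δ
    ∣N∣≡Δ x = trans (∣N∣≡degree x) (regular x)

    ∣∁N∣≡Δ : ∀ x → ∣ ∁ (N x) ∣ ≡ Δ
    ∣∁N∣≡Δ x = begin
      ∣ ∁ (N x) ∣     ≡⟨ ∣∁p∣≡n∸∣p∣ (N x) ⟩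
      n ∸ ∣ N x ∣     ≡⟨ cong₂ _∸_ n≡2Δ (∣N∣≡Δ x) ⟩
      Δ + (Δ + 0) ∸ Δ ≡⟨ m+n∸m≡n Δ (Δ + 0) ⟩
      Δ + 0           ≡⟨ +-identityʳ Δ ⟩
      Δ               ∎
      where open ≡-Reasoning

    N-∁ : ∀ {x y} → Adj x y → N x ≡ ∁ (N y)
    -- A common neighbour of x and y would complete a triangle, so `N x` lies in `∁ (N y)`; both
    -- have size Δ because n is 2Δ.
    N-∁ {x} {y} x~y = p⊆q∧∣p∣≡∣q∣⇒p≡q
      (λ z∈N → x∉p⇒x∈∁p λ z∈N′ →
        free x~y (∈-tabulate⁻ (adj? y) z∈N′) (∈-tabulate⁻ (adj? x) z∈N))
      (trans (∣N∣≡Δ x) (sym (∣∁N∣≡Δ y)))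

    u~v : Adj u v
    u~v = ∈-tabulate⁻ (adj? u) v∈N

    v~ : ∀ {x} → x ∉ N u → Adj v x
    v~ x∉N = ∈-tabulate⁻ (adj? v) (subst (_ ∈_) (sym (N-∁ (~-sym u~v))) (x∉p⇒x∈∁p x∉N))

lemma29 : ∀ (n Δ : ℕ) .{{_ : NonZero n}} (G : SimpleGraph (Fin n)) →
    Connected G → Regular Δ G → n ≡ 2 * Δ →
    (G ≅ completeBipartite Δ Δ) ⇔ (connectedSubsets 3 G ≡ n * (Δ C 2))
-- Matching on `suc _` provides the vertex `zero` from which the bipartition is built.
lemma29 n@(suc _) Δ G _ regular n≡2Δ = mk⇔
  (λ G≅K → to (≅-triangleFree G≅K (completeBipartite-triangleFree Δ Δ)))
  (λ k₃≡ → triangleFree⇒≅completeBipartite G zero regular n≡2Δ (from k₃≡))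
  where open Equivalence (triangleFree⇔count G regular)
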